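{- Let $N\ge 2$ and $m\ge 1$ be integers and let $x^{(r,s)}_k$ ($1\le r,s\le N$, $1\le k\le m$) be elements of a commutative ring; set $x^{(r,s)}_{m+1}=0$ for all $1\le r,s\le N$. Let $A(N,m)$ be the $Nm\times Nm$ matrix which, as an $N\times N$ block matrix with $m\times m$ blocks, has $(r,s)$ block $A_m(x^{(r,s)}_1,\dots,x^{(r,s)}_m)$. Then $$\det(A(N,m))=\prod_{i=1}^{m}\det(X_{(i,i+1)}).$$
   Context: For elements $x_1,\dots,x_m$, $A_m(x_1,\dots,x_m)$ is the $m\times m$ matrix whose $(p,q)$ entry is $x_{m+1-\min(p,q)}$ (first row and column constantly $x_m$, bottom-right entry $x_1$). For $1\le i\le m$, $X_{(i,i+1)}$ is the $N\times N$ matrix whose $(r,s)$ entry is $x^{(r,s)}_i-x^{(r,s)}_{i+1}$. -}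

module Defs where

open import Algebra.Bundles using (CommutativeRing; Semiring)
open import Data.Fin.Base using (Fin; zero; suc; toℕ; fromℕ; inject₁; opposite; quotient; remainder)
open import Data.Fin.Properties using (≤-totalOrder)
open import Data.Nat.Base using (ℕ; zero; suc)
import Data.Nat.Base as ℕ
open import Data.Vec.Functional using (Vector; insertAt; removeAt; map; tail)
import Algebra.Construct.NaturalChoice.Min as Min
import Algebra.Definitions.RawSemiring as RawSemiringDefinitions

-- Indices are 0-based throughout: an element of Fin n with value k stands for
-- the 1-based index k + 1.

module Matrices {c ℓ} (R : CommutativeRing c ℓ) where

  open CommutativeRing R hiding (zero)
  open RawSemiringDefinitions (Semiring.rawSemiring semiring) using (sum; product; _^_) public

  Matrix : ℕ → Set c
  Matrix n = Vector (Vector Carrier n) n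

  -- Laplace expansion along the first row; the 0 × 0 determinant is 1.
  det : ∀ {n} → Matrix n → Carrier
  det {zero}  _ = 1#
  det {suc n} M =
    sum λ j → (- 1#) ^ toℕ j * (M zero j * det (map (λ row → removeAt row j) (tail M)))

  -- In 1-based indices the entry is x_{m+1-min(p,q)}; `opposite` is the
  -- 1-based reflection k ↦ m+1-k.
  A-block : ∀ {m} → Vector Carrier m → Matrix m
  A-block {m} x p q = x (opposite (p ⊓ q))
    where open Min (≤-totalOrder m) using (_⊓_)

  -- The index a = r * m + p lies in block r = quotient at position p = remainder.
  blockMatrix : ∀ {N m} → (Fin N → Fin N → Matrix m) → Matrix (N ℕ.* m)
  blockMatrix {N} {m} B a b =
    B (quotient m a) (quotient m b) (remainder {N} m a) (remainder {N} m b)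

  module _ {N m : ℕ} (x : Fin N → Fin N → Vector Carrier m) where

    A : Matrix (N ℕ.* m)
    A = blockMatrix λ r s → A-block (x r s)

    -- x₁, …, x_m followed by x_{m+1} = 0
    extended : Fin N → Fin N → Vector Carrier (suc m)
    extended r s = insertAt (x r s) (fromℕ m) 0#

    -- X i is the matrix X_{(i,i+1)}.
    X : Fin m → Matrix N
    X i r s = extended r s (inject₁ i) - extended r s (suc i)

{-# OPTIONS --safe #-}
-- Every alternating multilinear function F of the rows of a square matrix
-- satisfies F M = det M · F 1. Applied to M ↦ det (M ∘ σ × σ), this shows that
-- det is unchanged when rows and columns are permuted simultaneously. Listing
-- the indices of A(N,m) by position first (in reverse order) and block second
-- turns it into an m × m block matrix whose (p,q) block is
-- (x^{(r,s)}_{max(p,q)})_{r,s}. Subtracting the second block row from the first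
-- leaves only X_{(1,2)} in the first block row, and the complementary block has the
-- same shape with x₁ dropped.
module Submission where

open import Defs
open import Algebra.Bundles using (CommutativeRing)
open import Data.Fin.Base
  using ( Fin; zero; suc; toℕ; opposite; quotient; remainder; remQuot; combine; punchIn
        ; pinch; splitAt; _↑ˡ_; _↑ʳ_ )
import Data.Fin.Base as Fin
open import Data.Fin.Permutation using (Permutation; _⟨$⟩ʳ_; _⟨$⟩ˡ_; inverseˡ; inverseʳ; ↔⇒≡; permutation)
open import Data.Fin.Properties
  using ( _≟_; toℕ-↑ˡ; ≤-totalOrder; ≤-total; suc-injective; ↑ˡ-injective; splitAt⁻¹-↑ˡ
        ; splitAt⁻¹-↑ʳ; remQuot-combine; combine-remQuot; opposite-involutive; opposite-prop )
open import Data.Nat.Base using (ℕ; zero; suc; _≤_)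
import Data.Nat.Base as ℕ
import Data.Nat.Properties as ℕ
open import Data.Product.Base using (_,_; proj₁; proj₂; ∃-syntax)
open import Data.Sum.Base using (_⊎_; inj₁; inj₂)
open import Data.Vec.Functional using (Vector; _∷_; _++_; insertAt; removeAt; map; tail; take; drop)
open import Data.Vec.Functional.Properties using (lookup-++ˡ; lookup-++ʳ)
open import Function.Base using (_∘_; id)
open import Level using (_⊔_)
open import Relation.Binary.PropositionalEquality as ≡ using (_≡_; _≢_)
open import Relation.Nullary.Decidable.Core using (yes; no)
open import Relation.Nullary.Negation using (contradiction)
import Algebra.Construct.NaturalChoice.Min as Min
import Algebra.Properties.Group as GroupProperties
import Algebra.Properties.Ring as RingProperties
import Algebra.Properties.Semiring.Sum as SemiringSum
import Algebra.Solver.Ring.NaturalCoefficients.Default as SemiringSolver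
import Data.Vec.Functional.Relation.Binary.Equality.Setoid as VectorEquality
import Relation.Binary.Reasoning.Setoid as SetoidReasoning

-- Arithmetic of finite indices.

punchIn-pinch : ∀ {n} (i : Fin (suc n)) (j : Fin n) → punchIn (punchIn i j) (pinch j i) ≡ i
punchIn-pinch zero    zero    = ≡.refl
punchIn-pinch zero    (suc j) = ≡.refl
punchIn-pinch (suc i) zero    = ≡.refl
punchIn-pinch (suc i) (suc j) = ≡.cong suc (punchIn-pinch i j)

-- Both sides enumerate in increasing order the indices other than `i` and `punchIn i j`. Hence
-- deleting two columns in either order leaves the same second minor.
punchIn-exchange : ∀ {n} (i : Fin (suc (suc n))) (j : Fin (suc n)) (k : Fin n) →
  punchIn (punchIn i j) (punchIn (pinch j i) k) ≡ punchIn i (punchIn j k)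
punchIn-exchange zero    zero    k       = ≡.refl
punchIn-exchange zero    (suc j) k       = ≡.refl
punchIn-exchange (suc i) zero    k       = ≡.refl
punchIn-exchange (suc i) (suc j) zero    = ≡.refl
punchIn-exchange (suc i) (suc j) (suc k) = ≡.cong suc (punchIn-exchange i j k)

punchIn-↑ˡ : ∀ {n} (i : Fin (suc n)) (j : Fin n) k → punchIn (i ↑ˡ k) (j ↑ˡ k) ≡ punchIn i j ↑ˡ k
punchIn-↑ˡ zero    j       k = ≡.refl
punchIn-↑ˡ (suc i) zero    k = ≡.refl
punchIn-↑ˡ (suc i) (suc j) k = ≡.cong suc (punchIn-↑ˡ i j k)

punchIn-↑ʳ : ∀ {n} (i : Fin (suc n)) {k} (j : Fin k) → punchIn (i ↑ˡ k) (n ↑ʳ j) ≡ suc n ↑ʳ j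
punchIn-↑ʳ         zero    j = ≡.refl
punchIn-↑ʳ {suc n} (suc i) j = ≡.cong suc (punchIn-↑ʳ i j)

↑ˡ≢↑ʳ : ∀ {m n} (i : Fin m) (j : Fin n) → i ↑ˡ n ≢ m ↑ʳ j
↑ˡ≢↑ʳ (suc i) j eq = ↑ˡ≢↑ʳ i j (suc-injective eq)

infixl 6 _⊔ᶠ_
-- Structural recursion makes `zero ⊔ᶠ j` and `suc i ⊔ᶠ suc j` compute, so that dropping x₁ from the
-- block matrix below becomes a shift by `suc` on both arguments.
_⊔ᶠ_ : ∀ {n} → Fin n → Fin n → Fin n
zero  ⊔ᶠ j     = j
suc i ⊔ᶠ zero  = suc i
suc i ⊔ᶠ suc j = suc (i ⊔ᶠ j)

i≤j⇒i⊔j≡j : ∀ {n} {i j : Fin n} → i Fin.≤ j → i ⊔ᶠ j ≡ j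
i≤j⇒i⊔j≡j {i = zero}              _           = ≡.refl
i≤j⇒i⊔j≡j {i = suc i} {j = suc j} (ℕ.s≤s i≤j) = ≡.cong suc (i≤j⇒i⊔j≡j i≤j)

i≥j⇒i⊔j≡i : ∀ {n} {i j : Fin n} → j Fin.≤ i → i ⊔ᶠ j ≡ i
i≥j⇒i⊔j≡i {i = zero}  {j = zero}  _           = ≡.refl
i≥j⇒i⊔j≡i {i = suc i} {j = zero}  _           = ≡.refl
i≥j⇒i⊔j≡i {i = suc i} {j = suc j} (ℕ.s≤s j≤i) = ≡.cong suc (i≥j⇒i⊔j≡i j≤i)

opposite-antitone : ∀ {n} {i j : Fin n} → i Fin.≤ j → opposite j Fin.≤ opposite i
opposite-antitone {n} {i} {j} i≤j =
  ≡.subst₂ ℕ._≤_ (≡.sym (opposite-prop j)) (≡.sym (opposite-prop i)) (ℕ.∸-monoʳ-≤ n (ℕ.s≤s i≤j))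

-- `opposite` is an order-reversing involution, so it carries minima to maxima. This accounts for
-- the passage from `A-block` to `maxBlocks`.
opposite-⊓ : ∀ {n} (i j : Fin n) → let open Min (≤-totalOrder n) using (_⊓_) in
  opposite (opposite i ⊓ opposite j) ≡ i ⊔ᶠ j
opposite-⊓ {n} i j with ≤-total i j
... | inj₁ i≤j = ≡.trans (≡.cong opposite (Min.x≤y⇒y⊓x≈x (≤-totalOrder n) (opposite-antitone i≤j)))
                (≡.trans (opposite-involutive j) (≡.sym (i≤j⇒i⊔j≡j i≤j)))
... | inj₂ j≤i = ≡.trans (≡.cong opposite (Min.x≤y⇒x⊓y≈x (≤-totalOrder n) (opposite-antitone j≤i)))
                (≡.trans (opposite-involutive i) (≡.sym (i≥j⇒i⊔j≡i j≤i)))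

quotient-combine : ∀ {m n} (i : Fin m) (j : Fin n) → quotient n (combine i j) ≡ i
quotient-combine i j = ≡.cong proj₁ (remQuot-combine i j)

remainder-combine : ∀ {m n} (i : Fin m) (j : Fin n) → remainder {m} n (combine i j) ≡ j
remainder-combine i j = ≡.cong proj₂ (remQuot-combine i j)

-- Besides transposing the two levels of indexing, the map reverses positions: x₁ then occurs only
-- in the top left block, and peeling off the first block row meets the factors in the order in
-- which `product` lists them.
positionFirst : ∀ N m → Permutation (m ℕ.* N) (N ℕ.* m)
positionFirst N m = permutation to from
  (λ a → ≡.trans (≡.cong₂ combine (remainder-combine (opposite (remainder {N} m a)) (quotient {N} m a))
                   (≡.trans (≡.cong opposite (quotient-combine (opposite (remainder {N} m a)) (quotient {N} m a)))
                            (opposite-involutive _)))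
                 (combine-remQuot {N} m a))
  (λ a → ≡.trans (≡.cong₂ combine (≡.trans (≡.cong opposite (remainder-combine (remainder {m} N a) (opposite (quotient {m} N a))))
                                           (opposite-involutive _))
                   (quotient-combine (remainder {m} N a) (opposite (quotient {m} N a))))
                 (combine-remQuot {m} N a))
  where
  to : Fin (m ℕ.* N) → Fin (N ℕ.* m)
  to a = combine (remainder {m} N a) (opposite (quotient {m} N a))
  from : Fin (N ℕ.* m) → Fin (m ℕ.* N)
  from a = combine (opposite (remainder {N} m a)) (quotient {N} m a)

module Determinants {c ℓ} (R : CommutativeRing c ℓ) where

  open CommutativeRing R hiding (zero)
  open Matrices R
  open GroupProperties +-group using (inverseˡ-unique; ε⁻¹≈ε; ⁻¹-involutive)
  open RingProperties ring using (-1*x≈-x)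
  open SemiringSum semiring using (sum-cong-≋; ∑-distrib-+; *-distribˡ-sum; *-distribʳ-sum; sum-replicate-zero)
  open SemiringSolver commutativeSemiring using (solve; _:=_; _:+_; _:*_; con)
  open VectorEquality setoid using (_≋_; ≋-sym; ≋-trans)
  open SetoidReasoning setoid

  -- Finite sums and signs.

  sum-zero : ∀ {n} {f : Vector Carrier n} → (∀ i → f i ≈ 0#) → sum f ≈ 0#
  sum-zero {n} f≈0 = trans (sum-cong-≋ f≈0) (sum-replicate-zero n)

  sum-linear : ∀ {n} a {f g h : Vector Carrier n} →
    (∀ i → f i ≈ g i + a * h i) → sum f ≈ sum g + a * sum h
  sum-linear a {f} {g} {h} eq = begin
    sum f                              ≈⟨ sum-cong-≋ eq ⟩
    sum (λ i → g i + a * h i)          ≈⟨ ∑-distrib-+ g (map (a *_) h) ⟩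
    sum g + sum (map (a *_) h)         ≈⟨ +-congˡ (*-distribˡ-sum a h) ⟨
    sum g + a * sum h                  ∎

  sum-↑ : ∀ m {n} (f : Vector Carrier (m ℕ.+ n)) → sum f ≈ sum (take m f) + sum (drop m f)
  sum-↑ zero    f = sym (+-identityˡ _)
  sum-↑ (suc m) f = trans (+-congˡ (sum-↑ m (tail f))) (sym (+-assoc _ _ _))

  -- The pairs (i , j) index the ordered pairs of distinct elements i, punchIn i j;
  -- the pair with the two elements exchanged is (punchIn i j , pinch j i).
  sum-antisymmetric : ∀ {n} (f : Fin (suc n) → Fin n → Carrier) →
    (∀ i j → f i j + f (punchIn i j) (pinch j i) ≈ 0#) → sum (λ i → sum (f i)) ≈ 0#
  sum-antisymmetric {zero}  f anti = +-identityˡ 0#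
  sum-antisymmetric {suc n} f anti = begin
    -- Exchange matches the pair (`zero` , i) with (`suc i` , `zero`), so the pairs containing
    -- `zero` cancel by `anti zero`. The other pairs are those of `g`, which is antisymmetric again.
    sum (f zero) + sum (λ i → f (suc i) zero + sum (g i))
      ≈⟨ +-congˡ (∑-distrib-+ (λ i → f (suc i) zero) (λ i → sum (g i))) ⟩
    sum (f zero) + (sum (λ i → f (suc i) zero) + sum (λ i → sum (g i)))
      ≈⟨ +-assoc _ _ _ ⟨
    sum (f zero) + sum (λ i → f (suc i) zero) + sum (λ i → sum (g i))
      ≈⟨ +-cong (∑-distrib-+ (f zero) (λ i → f (suc i) zero)) refl ⟨
    sum (λ i → f zero i + f (suc i) zero) + sum (λ i → sum (g i))
      ≈⟨ +-cong (sum-zero (anti zero)) (sum-antisymmetric g (λ i j → anti (suc i) (suc j))) ⟩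
    0# + 0#
      ≈⟨ +-identityˡ 0# ⟩
    0# ∎
    where
    g : Fin (suc n) → Fin n → Carrier
    g i j = f (suc i) (suc j)

  sign : ∀ {n} → Fin n → Carrier
  sign i = (- 1#) ^ toℕ i

  -- If j ≥ i, the exchanged pair is (j + 1 , i); if j < i, it is (j , i - 1). Either way the sum of
  -- the two indices changes by exactly one.
  sign-exchange : ∀ {n} (i : Fin (suc n)) (j : Fin n) →
    sign (punchIn i j) * sign (pinch j i) ≈ - (sign i * sign j)
  sign-exchange zero zero = begin
    (- 1# * 1#) * 1#  ≈⟨ *-assoc _ _ _ ⟩
    - 1# * (1# * 1#)  ≈⟨ -1*x≈-x _ ⟩
    - (1# * 1#)       ∎
  sign-exchange zero (suc j) = begin
    (- 1# * s) * 1#   ≈⟨ solve 2 (λ m s → (m :* s) :* con 1 := m :* (con 1 :* s)) refl (- 1#) s ⟩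
    - 1# * (1# * s)   ≈⟨ -1*x≈-x _ ⟩
    - (1# * s)        ∎
    where s = sign (suc j)
  sign-exchange (suc i) zero = begin
    -- The exponent drops by one in this case, so a factor `- 1# * - 1#` is created before one
    -- `- 1#` is pulled out.
    1# * s                        ≈⟨ *-congʳ -1*-1≈1 ⟨
    (- 1# * - 1#) * s             ≈⟨ solve 2 (λ m s → (m :* m) :* s := m :* ((m :* s) :* con 1)) refl (- 1#) s ⟩
    - 1# * ((- 1# * s) * 1#)      ≈⟨ -1*x≈-x _ ⟩
    - ((- 1# * s) * 1#)           ∎
    where
    s = sign i
    -1*-1≈1 : - 1# * - 1# ≈ 1#
    -1*-1≈1 = trans (-1*x≈-x _) (⁻¹-involutive 1#)
  sign-exchange (suc i) (suc j) = begin
    (- 1# * sign (punchIn i j)) * (- 1# * sign (pinch j i))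
      ≈⟨ solve 3 (λ m s t → (m :* s) :* (m :* t) := (m :* m) :* (s :* t)) refl (- 1#) _ _ ⟩
    (- 1# * - 1#) * (sign (punchIn i j) * sign (pinch j i))
      ≈⟨ *-congˡ (trans (sign-exchange i j) (sym (-1*x≈-x _))) ⟩
    (- 1# * - 1#) * (- 1# * (sign i * sign j))
      ≈⟨ solve 3 (λ m s t → (m :* m) :* (m :* (s :* t)) := m :* ((m :* s) :* (m :* t))) refl (- 1#) _ _ ⟩
    - 1# * ((- 1# * sign i) * (- 1# * sign j))
      ≈⟨ -1*x≈-x _ ⟩
    - ((- 1# * sign i) * (- 1# * sign j)) ∎

  -- Alternating multilinear functions of the rows

  Rows : ℕ → ℕ → Set c
  Rows n d = Vector (Vector Carrier d) n

  -- Linearity in row `i` relates three matrices that agree in the other rows, instead of updating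
  -- one matrix; in this form it transports along any `IsRowMap`. The row length `d` is independent
  -- of `n`, so the rows of a non-square part of a matrix can serve as the argument.
  record IsMultilinear {n d} (F : Rows n d → Carrier) : Set (c ⊔ ℓ) where
    field
      F-cong : ∀ {M M′} → (∀ i → M i ≋ M′ i) → F M ≈ F M′
      linear : ∀ i a M M₁ M₂ →
        (∀ j → j ≢ i → M j ≋ M₁ j) → (∀ j → j ≢ i → M j ≋ M₂ j) →
        (∀ k → M i k ≈ M₁ i k + a * M₂ i k) → F M ≈ F M₁ + a * F M₂

    zero-row : ∀ i M → (∀ k → M i k ≈ 0#) → F M ≈ 0#
    zero-row i M Mᵢ≈0 = begin
      -- A zero row equals itself minus itself, so `linear` applies with `M` in all three places and
      -- coefficient -1.
      F M                  ≈⟨ linear i (- 1#) M M M (λ _ _ _ → refl) (λ _ _ _ → refl) split ⟩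
      F M + - 1# * F M     ≈⟨ +-congˡ (-1*x≈-x _) ⟩
      F M - F M            ≈⟨ -‿inverseʳ _ ⟩
      0#                   ∎
      where
      split : ∀ k → M i k ≈ M i k + - 1# * M i k
      split k = begin
        M i k                   ≈⟨ +-identityʳ _ ⟨
        M i k + 0#              ≈⟨ +-congˡ (zeroʳ _) ⟨
        M i k + - 1# * 0#       ≈⟨ +-congˡ (*-congˡ (Mᵢ≈0 k)) ⟨
        M i k + - 1# * M i k    ∎

  -- Vanishing on two equal rows is the right axiom over a general commutative ring: a sign change
  -- under exchange does not imply it where 2 cannot be cancelled.
  record IsAlternating {n d} (F : Rows n d → Carrier) : Set (c ⊔ ℓ) where
    field
      isMultilinear : IsMultilinear F
      vanishes : ∀ {i j} → i ≢ j → ∀ M → M i ≋ M j → F M ≈ 0#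
    open IsMultilinear isMultilinear public

  -- Φ moves row i to row `index i`, transforms it linearly, and fills the
  -- remaining rows with constants.
  record IsRowMap {n d n′ d′} (Φ : Rows n d → Rows n′ d′) : Set (c ⊔ ℓ) where
    field
      index : Fin n → Fin n′
      index-injective : ∀ {i j} → index i ≡ index j → i ≡ j
      transform : Vector Carrier d → Vector Carrier d′
      transform-linear : ∀ a {u v w} → (∀ k → u k ≈ v k + a * w k) →
        ∀ k → transform u k ≈ transform v k + a * transform w k
      at-index : ∀ M i k → Φ M (index i) k ≈ transform (M i) k
      local : ∀ {M M′} j → (∀ i → index i ≡ j → M i ≋ M′ i) → Φ M j ≋ Φ M′ j

    transform-cong : ∀ {u v} → u ≋ v → transform u ≋ transform v
    transform-cong {u} {v} u≋v k = begin
      transform u k                           ≈⟨ transform-linear 0# (λ l → trans (u≋v l) (sym (+0* l))) k ⟩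
      transform v k + 0# * transform v k      ≈⟨ trans (+-congˡ (zeroˡ _)) (+-identityʳ _) ⟩
      transform v k                           ∎
      where
      +0* : ∀ l → v l + 0# * v l ≈ v l
      +0* l = trans (+-congˡ (zeroˡ _)) (+-identityʳ _)

  module _ {n d n′ d′} {Φ : Rows n d → Rows n′ d′} (Φ-map : IsRowMap Φ) where
    open IsRowMap Φ-map

    multilinear-∘ : ∀ {F} → IsMultilinear F → IsMultilinear (F ∘ Φ)
    multilinear-∘ {F} F-multi = record
      { F-cong = λ M≋M′ → F-cong (λ j → local j (λ i _ → M≋M′ i))
      ; linear = λ i a M M₁ M₂ M≋M₁ M≋M₂ Mᵢ≈ → linear (index i) a (Φ M) (Φ M₁) (Φ M₂)
          -- A row `i′` that is sent to `j ≢ index i` is not row `i`, so the matrices agree in it.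
          (λ j j≢ → local j (λ i′ i′↦j → M≋M₁ i′ λ { ≡.refl → j≢ (≡.sym i′↦j) }))
          (λ j j≢ → local j (λ i′ i′↦j → M≋M₂ i′ λ { ≡.refl → j≢ (≡.sym i′↦j) }))
          (λ k → trans (at-index M i k) (trans (transform-linear a Mᵢ≈ k)
            (+-cong (sym (at-index M₁ i k)) (*-congˡ (sym (at-index M₂ i k))))))
      }
      where open IsMultilinear F-multi

    alternating-∘ : ∀ {F} → IsAlternating F → IsAlternating (F ∘ Φ)
    alternating-∘ {F} F-alt = record
      { isMultilinear = multilinear-∘ isMultilinear
      ; vanishes = λ {i} {j} i≢j M Mᵢ≋Mⱼ → vanishes (i≢j ∘ index-injective) (Φ M)
          (λ k → trans (at-index M i k) (trans (transform-cong Mᵢ≋Mⱼ k) (sym (at-index M j k))))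
      }
      where open IsAlternating F-alt

  -- Freezing the first row turns `F` into a function of one row fewer; the inductions for `shear`,
  -- `alternating-rotate` and `alternating-unique` run this way.
  ∷-isRowMap : ∀ {n d} (u : Vector Carrier d) → IsRowMap {n} (u ∷_)
  ∷-isRowMap u = record
    { index = suc
    ; index-injective = suc-injective
    ; transform = id
    ; transform-linear = λ _ eq → eq
    ; at-index = λ _ _ _ → refl
    ; local = λ { zero _ _ → refl ; (suc j) M≋M′ → M≋M′ j ≡.refl }
    }

  ++-isRowMap : ∀ {m n d} (w : Rows n d) → IsRowMap {m} (_++ w)
  ++-isRowMap {m} {n} w = record
    { index = _↑ˡ n
    ; index-injective = λ {i} {j} → ↑ˡ-injective n i j
    ; transform = id
    ; transform-linear = λ _ eq → eq
    ; at-index = λ v i k → reflexive (≡.cong-app (lookup-++ˡ v w i) k)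
    ; local = local
    }
    where
    local : ∀ {v v′} j → (∀ i → i ↑ˡ n ≡ j → v i ≋ v′ i) → (v ++ w) j ≋ (v′ ++ w) j
    local j v≋v′ with splitAt m j in eq
    ... | inj₁ i = v≋v′ i (splitAt⁻¹-↑ˡ eq)
    ... | inj₂ i = λ _ → refl

  ∷-eta : ∀ {n d} (M : Rows (suc n) d) → ∀ i → M i ≋ (M zero ∷ tail M) i
  ∷-eta M zero    _ = refl
  ∷-eta M (suc i) _ = refl

  ++-eta : ∀ m {n d} (M : Rows (m ℕ.+ n) d) → ∀ i → M i ≋ (take m M ++ drop m M) i
  ++-eta m M i k with splitAt m i in eq
  ... | inj₁ j = reflexive (≡.cong (λ i → M i k) (≡.sym (splitAt⁻¹-↑ˡ eq)))
  ... | inj₂ j = reflexive (≡.cong (λ i → M i k) (≡.sym (splitAt⁻¹-↑ʳ eq)))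

  module _ {n d} {F : Rows (suc n) d → Carrier} (F-multi : IsMultilinear F) where
    open IsMultilinear F-multi

    linear-head : ∀ a {u v w} M → (∀ k → u k ≈ v k + a * w k) →
      F (u ∷ M) ≈ F (v ∷ M) + a * F (w ∷ M)
    linear-head a M = linear zero a _ _ _ others others
      where
      others : ∀ {u v : Vector Carrier d} j → j ≢ zero → (u ∷ M) j ≋ (v ∷ M) j
      others zero    j≢0 = contradiction ≡.refl j≢0
      others (suc j) _ _ = refl

    linear-head-sum : ∀ {m} (a : Vector Carrier m) (E : Rows m d) M →
      F ((λ k → sum λ j → a j * E j k) ∷ M) ≈ sum (λ j → a j * F (E j ∷ M))
    linear-head-sum {zero}  a E M = zero-row zero _ (λ _ → refl)
    linear-head-sum {suc m} a E M = begin
      F ((λ k → a zero * E zero k + rest k) ∷ M)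
        ≈⟨ linear-head (a zero) M (λ k → +-comm _ _) ⟩
      F (rest ∷ M) + a zero * F (E zero ∷ M)
        ≈⟨ +-comm _ _ ⟩
      a zero * F (E zero ∷ M) + F (rest ∷ M)
        ≈⟨ +-congˡ (linear-head-sum (tail a) (tail E) M) ⟩
      a zero * F (E zero ∷ M) + sum (λ j → a (suc j) * F (E (suc j) ∷ M)) ∎
      where
      rest : Vector Carrier d
      rest k = sum λ j → a (suc j) * E (suc j) k

  -- Row reduction: rows are replaced from the top down, and each replacement leaves an extra term
  -- with `g i` in row `i`, which is killed. The hypothesis allows arbitrary other rows because the
  -- intermediate matrices mix rows of `M` and `M′`.
  shear : ∀ {n d} {F : Rows n d → Carrier} → IsMultilinear F → (g : Rows n d) →
    (∀ i M → M i ≋ g i → F M ≈ 0#) → (a : Vector Carrier n) → ∀ M M′ →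
    (∀ i k → M i k ≈ M′ i k + a i * g i k) → F M ≈ F M′
  shear {zero}          F-multi g kills a M M′ eq = IsMultilinear.F-cong F-multi λ ()
  shear {suc n} {F = F} F-multi g kills a M M′ eq = begin
    F M                                                  ≈⟨ F-cong (∷-eta M) ⟩
    F (M zero ∷ tail M)                                  ≈⟨ linear-head F-multi (a zero) (tail M) (eq zero) ⟩
    F (M′ zero ∷ tail M) + a zero * F (g zero ∷ tail M)  ≈⟨ +-congˡ (trans (*-congˡ (kills zero _ λ _ → refl)) (zeroʳ _)) ⟩
    F (M′ zero ∷ tail M) + 0#                            ≈⟨ +-identityʳ _ ⟩
    F (M′ zero ∷ tail M)                                 ≈⟨ shear (multilinear-∘ (∷-isRowMap (M′ zero)) F-multi) (tail g) (λ i N → kills (suc i) (M′ zero ∷ N)) (tail a) (tail M) (tail M′) (λ i → eq (suc i)) ⟩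
    F (M′ zero ∷ tail M′)                                ≈⟨ F-cong (∷-eta M′) ⟨
    F M′                                                 ∎
    where open IsMultilinear F-multi

  module _ {n d} {F : Rows (suc (suc n)) d → Carrier} (F-multi : IsMultilinear F)
           (vanishes₀₁ : ∀ M → M zero ≋ M (suc zero) → F M ≈ 0#) where
    open IsMultilinear F-multi

    -- Expand `F` at two equal first rows u + v: the two diagonal terms vanish as well. Only the
    -- first two rows are assumed to alternate, since the determinant uses this before its full
    -- alternation is known.
    swap-head : ∀ u v M → F (u ∷ v ∷ M) ≈ - F (v ∷ u ∷ M)
    swap-head u v M = inverseˡ-unique _ _ (sym (begin
      0#
        ≈⟨ vanishes₀₁ (u+v ∷ u+v ∷ M) (λ _ → refl) ⟨
      F (u+v ∷ u+v ∷ M)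
        ≈⟨ linear-head F-multi 1# (u+v ∷ M) (λ _ → refl) ⟩
      F (u ∷ u+v ∷ M) + 1# * F (v ∷ u+v ∷ M)
        ≈⟨ +-cong (expand u) (trans (*-identityˡ _) (expand v)) ⟩
      (F (u ∷ u ∷ M) + F (u ∷ v ∷ M)) + (F (v ∷ u ∷ M) + F (v ∷ v ∷ M))
        ≈⟨ +-cong (trans (+-congʳ (vanishes₀₁ _ λ _ → refl)) (+-identityˡ _))
                  (trans (+-congˡ (vanishes₀₁ _ λ _ → refl)) (+-identityʳ _)) ⟩
      F (u ∷ v ∷ M) + F (v ∷ u ∷ M) ∎))
      where
      u+v : Vector Carrier d
      u+v k = u k + 1# * v k
      expand : ∀ w → F (w ∷ u+v ∷ M) ≈ F (w ∷ u ∷ M) + F (w ∷ v ∷ M)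
      expand w = trans (linear-head (multilinear-∘ (∷-isRowMap w) F-multi) 1# M (λ _ → refl))
                       (+-congˡ (*-identityˡ _))

  -- The determinant is alternating multilinear

  minor : ∀ {n} → Matrix (suc n) → Fin (suc n) → Matrix n
  minor M j = map (λ row → removeAt row j) (tail M)

  det-cong : ∀ {n} {M M′ : Matrix n} → (∀ i → M i ≋ M′ i) → det M ≈ det M′
  det-cong {zero}  eq = refl
  det-cong {suc n} eq = sum-cong-≋ λ j →
    *-congˡ {x = sign j} (*-cong (eq zero j) (det-cong (λ i k → eq (suc i) (punchIn j k))))

  det-multilinear : ∀ {n} → IsMultilinear (det {n})
  det-multilinear = record { F-cong = det-cong ; linear = det-linear }
    where
    det-linear : ∀ {n} (i : Fin n) a (M M₁ M₂ : Matrix n) →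
      (∀ j → j ≢ i → M j ≋ M₁ j) → (∀ j → j ≢ i → M j ≋ M₂ j) →
      (∀ k → M i k ≈ M₁ i k + a * M₂ i k) → det M ≈ det M₁ + a * det M₂
    det-linear zero a M M₁ M₂ M≋M₁ M≋M₂ M₀≈ = sum-linear a λ j → begin
      sign j * (M zero j * det (minor M j))
        ≈⟨ *-congˡ (*-congʳ (M₀≈ j)) ⟩
      sign j * ((M₁ zero j + a * M₂ zero j) * det (minor M j))
        ≈⟨ solve 5 (λ s p a q D → s :* ((p :+ a :* q) :* D) := s :* (p :* D) :+ a :* (s :* (q :* D))) refl _ _ _ _ _ ⟩
      sign j * (M₁ zero j * det (minor M j)) + a * (sign j * (M₂ zero j * det (minor M j)))
        ≈⟨ +-cong (*-congˡ (*-congˡ (det-cong λ i k → M≋M₁ (suc i) (λ ()) (punchIn j k))))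
                  (*-congˡ (*-congˡ (*-congˡ (det-cong λ i k → M≋M₂ (suc i) (λ ()) (punchIn j k))))) ⟩
      sign j * (M₁ zero j * det (minor M₁ j)) + a * (sign j * (M₂ zero j * det (minor M₂ j))) ∎
    det-linear (suc i) a M M₁ M₂ M≋M₁ M≋M₂ Mᵢ≈ = sum-linear a λ j → begin
      sign j * (M zero j * det (minor M j))
        ≈⟨ *-congˡ (*-congˡ (det-linear i a (minor M j) (minor M₁ j) (minor M₂ j)
             (λ i′ i′≢i k → M≋M₁ (suc i′) (i′≢i ∘ suc-injective) (punchIn j k))
             (λ i′ i′≢i k → M≋M₂ (suc i′) (i′≢i ∘ suc-injective) (punchIn j k))
             (λ k → Mᵢ≈ (punchIn j k)))) ⟩
      sign j * (M zero j * (det (minor M₁ j) + a * det (minor M₂ j)))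
        ≈⟨ solve 5 (λ s p a D E → s :* (p :* (D :+ a :* E)) := s :* (p :* D) :+ a :* (s :* (p :* E))) refl _ _ _ _ _ ⟩
      sign j * (M zero j * det (minor M₁ j)) + a * (sign j * (M zero j * det (minor M₂ j)))
        ≈⟨ +-cong (*-congˡ (*-congʳ (M≋M₁ zero (λ ()) j)))
                  (*-congˡ (*-congˡ (*-congʳ (M≋M₂ zero (λ ()) j)))) ⟩
      sign j * (M₁ zero j * det (minor M₁ j)) + a * (sign j * (M₂ zero j * det (minor M₂ j))) ∎

  -- Expanding along two rows gives a sum over ordered pairs of distinct columns. When the rows
  -- agree, exchanging the pair preserves the entries and the second minor but flips the sign.
  det-vanishes₀₁ : ∀ {n} (M : Matrix (suc (suc n))) → M zero ≋ M (suc zero) → det M ≈ 0#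
  det-vanishes₀₁ {n} M M₀≋M₁ = begin
    det M
      ≈⟨ sum-cong-≋ (λ i → trans (*-congˡ {x = sign i} (*-distribˡ-sum (M zero i) (λ j → sign j * (M (suc zero) (punchIn i j) * minor₂ i j))))
           (*-distribˡ-sum (sign i) (λ j → M zero i * (sign j * (M (suc zero) (punchIn i j) * minor₂ i j))))) ⟩
    sum (λ i → sum (term i))
      ≈⟨ sum-antisymmetric term cancel ⟩
    0# ∎
    where
    minor₂ : Fin (suc (suc n)) → Fin (suc n) → Carrier
    minor₂ i j = det (minor (minor M i) j)
    term : Fin (suc (suc n)) → Fin (suc n) → Carrier
    term i j = sign i * (M zero i * (sign j * (M (suc zero) (punchIn i j) * minor₂ i j)))
    cancel : ∀ i j → term i j + term (punchIn i j) (pinch j i) ≈ 0#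
    cancel i j = begin
      term i j + sign i′ * (M zero i′ * (sign j′ * (M (suc zero) (punchIn i′ j′) * minor₂ i′ j′)))
        ≈⟨ +-congˡ (*-congˡ (*-cong (M₀≋M₁ i′) (*-congˡ (*-cong
             (trans (reflexive (≡.cong (M (suc zero)) (punchIn-pinch i j))) (sym (M₀≋M₁ i)))
             (det-cong λ r k → reflexive (≡.cong (M (suc (suc r))) (punchIn-exchange i j k))))))) ⟩
      term i j + sign i′ * (M (suc zero) i′ * (sign j′ * (M zero i * minor₂ i j)))
        ≈⟨ +-cong (gather _ _ _ _ _) (solve 5 (λ s p t q D → s :* (p :* (t :* (q :* D))) := (s :* t) :* (q :* (p :* D))) refl _ _ _ _ _) ⟩
      (sign i * sign j) * product′ + (sign i′ * sign j′) * product′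
        ≈⟨ distribʳ _ _ _ ⟨
      (sign i * sign j + sign i′ * sign j′) * product′
        ≈⟨ *-congʳ (trans (+-congˡ (sign-exchange i j)) (-‿inverseʳ _)) ⟩
      0# * product′
        ≈⟨ zeroˡ _ ⟩
      0# ∎
      where
      i′ = punchIn i j
      j′ = pinch j i
      product′ = M zero i * (M (suc zero) i′ * minor₂ i j)
      gather : ∀ s p t q D → s * (p * (t * (q * D))) ≈ (s * t) * (p * (q * D))
      gather = solve 5 (λ s p t q D → s :* (p :* (t :* (q :* D))) := (s :* t) :* (p :* (q :* D))) refl

  det-minors-vanish : ∀ {n} (M : Matrix (suc n)) → (∀ k → det (minor M k) ≈ 0#) → det M ≈ 0#
  det-minors-vanish M minors≈0 = sum-zero λ k →
    trans (*-congˡ (trans (*-congˡ (minors≈0 k)) (zeroʳ (M zero k)))) (zeroʳ (sign k))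

  -- If the equal row is not adjacent, exchanging rows 0 and 1 puts both equal rows below the first.
  -- Every minor of the expansion then has its own first row repeated, one place nearer.
  det-vanishes₀ : ∀ {n} (j : Fin n) (M : Matrix (suc n)) → M zero ≋ M (suc j) → det M ≈ 0#
  det-vanishes₀         zero    M M₀≋Mⱼ = det-vanishes₀₁ M M₀≋Mⱼ
  det-vanishes₀ {suc n} (suc j) M M₀≋Mⱼ = begin
    det M           ≈⟨ det-cong eta₂ ⟩
    det (M zero ∷ M (suc zero) ∷ tail (tail M))
                    ≈⟨ swap-head det-multilinear det-vanishes₀₁ (M zero) (M (suc zero)) (tail (tail M)) ⟩
    - det swapped   ≈⟨ -‿cong (det-minors-vanish swapped λ k → det-vanishes₀ j (minor swapped k) (M₀≋Mⱼ ∘ punchIn k)) ⟩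
    - 0#            ≈⟨ ε⁻¹≈ε ⟩
    0#              ∎
    where
    swapped : Matrix (suc (suc n))
    swapped = M (suc zero) ∷ M zero ∷ tail (tail M)
    eta₂ : ∀ i → M i ≋ (M zero ∷ M (suc zero) ∷ tail (tail M)) i
    eta₂ zero          _ = refl
    eta₂ (suc zero)    _ = refl
    eta₂ (suc (suc i)) _ = refl

  det-vanishes : ∀ {n} {i j : Fin n} → i ≢ j → (M : Matrix n) → M i ≋ M j → det M ≈ 0#
  det-vanishes {i = zero}  {zero}  i≢j M Mᵢ≋Mⱼ = contradiction ≡.refl i≢j
  det-vanishes {i = zero}  {suc j} i≢j M Mᵢ≋Mⱼ = det-vanishes₀ j M Mᵢ≋Mⱼ
  det-vanishes {i = suc i} {zero}  i≢j M Mᵢ≋Mⱼ = det-vanishes₀ i M (≋-sym Mᵢ≋Mⱼ)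
  det-vanishes {i = suc i} {suc j} i≢j M Mᵢ≋Mⱼ = det-minors-vanish M λ k →
    det-vanishes (i≢j ∘ ≡.cong suc) (minor M k) (Mᵢ≋Mⱼ ∘ punchIn k)

  det-alternating : ∀ {n} → IsAlternating (det {n})
  det-alternating = record { isMultilinear = det-multilinear ; vanishes = det-vanishes }

  -- Uniqueness of the determinant

  -- Recursion on both indices lets unit vectors compute together with `tail`, `insertAt` and
  -- `removeAt`.
  identity : ∀ {n} → Matrix n
  identity zero    zero    = 1#
  identity zero    (suc j) = 0#
  identity (suc i) zero    = 0#
  identity (suc i) (suc j) = identity i j

  identity-diagonal : ∀ {n} (i : Fin n) → identity i i ≡ 1#
  identity-diagonal zero    = ≡.refl
  identity-diagonal (suc i) = identity-diagonal i

  identity-off-diagonal : ∀ {n} {i j : Fin n} → i ≢ j → identity i j ≡ 0#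
  identity-off-diagonal {i = zero}  {zero}  i≢j = contradiction ≡.refl i≢j
  identity-off-diagonal {i = zero}  {suc j} i≢j = ≡.refl
  identity-off-diagonal {i = suc i} {zero}  i≢j = ≡.refl
  identity-off-diagonal {i = suc i} {suc j} i≢j = identity-off-diagonal (i≢j ∘ ≡.cong suc)

  identity-injective : ∀ {m n} (f : Fin m → Fin n) → (∀ {i j} → f i ≡ f j → i ≡ j) →
    ∀ i j → identity (f i) (f j) ≡ identity i j
  identity-injective f f-injective i j with i ≟ j
  ... | yes ≡.refl = ≡.trans (identity-diagonal (f i)) (≡.sym (identity-diagonal i))
  ... | no i≢j     = ≡.trans (identity-off-diagonal (i≢j ∘ f-injective)) (≡.sym (identity-off-diagonal i≢j))

  sum-identity : ∀ {n} (w : Vector Carrier n) k → w k ≈ sum (λ j → w j * identity j k)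
  sum-identity w zero    = sym (trans (+-cong (*-identityʳ _) (sum-zero λ j → zeroʳ (w (suc j)))) (+-identityʳ _))
  sum-identity w (suc k) = sym (trans (+-cong (zeroʳ _) (sym (sum-identity (tail w) k))) (+-identityˡ _))

  insertAt-identity : ∀ {n} (j : Fin (suc n)) i k → insertAt (identity i) j 0# k ≡ identity (punchIn j i) k
  insertAt-identity zero    i       zero    = ≡.refl
  insertAt-identity zero    i       (suc k) = ≡.refl
  insertAt-identity (suc j) zero    zero    = ≡.refl
  insertAt-identity (suc j) zero    (suc k) = insertAt-zeros j k
    where
    insertAt-zeros : ∀ {n} (j : Fin (suc n)) k → insertAt (λ (_ : Fin n) → 0#) j 0# k ≡ 0#
    insertAt-zeros         zero    zero    = ≡.refl
    insertAt-zeros         zero    (suc k) = ≡.refl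
    insertAt-zeros {suc n} (suc j) zero    = ≡.refl
    insertAt-zeros {suc n} (suc j) (suc k) = insertAt-zeros j k
  insertAt-identity (suc j) (suc i) zero    = ≡.refl
  insertAt-identity (suc j) (suc i) (suc k) = insertAt-identity j i k

  split-coordinate : ∀ {n} (w : Vector Carrier (suc n)) j k →
    w k ≈ insertAt (removeAt w j) j 0# k + w j * identity j k
  split-coordinate         w zero    zero    = sym (trans (+-identityˡ _) (*-identityʳ _))
  split-coordinate         w zero    (suc k) = sym (trans (+-congˡ (zeroʳ _)) (+-identityʳ _))
  split-coordinate {suc n} w (suc j) zero    = sym (trans (+-congˡ (zeroʳ _)) (+-identityʳ _))
  split-coordinate {suc n} w (suc j) (suc k) = split-coordinate (tail w) j k

  insertAt-linear : ∀ {n} (j : Fin (suc n)) a {u v w : Vector Carrier n} →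
    (∀ k → u k ≈ v k + a * w k) →
    ∀ k → insertAt u j 0# k ≈ insertAt v j 0# k + a * insertAt w j 0# k
  insertAt-linear         zero    a eq zero    = sym (trans (+-identityˡ _) (zeroʳ a))
  insertAt-linear         zero    a eq (suc k) = eq k
  insertAt-linear {suc n} (suc j) a eq zero    = eq zero
  insertAt-linear {suc n} (suc j) a eq (suc k) = insertAt-linear j a (λ l → eq (suc l)) k

  insertAt-isRowMap : ∀ {n d} (j : Fin (suc d)) → IsRowMap {n} (map λ (row : Vector Carrier d) → insertAt row j 0#)
  insertAt-isRowMap j = record
    { index = id
    ; index-injective = id
    ; transform = λ row → insertAt row j 0#
    ; transform-linear = insertAt-linear j
    ; at-index = λ _ _ _ → refl
    ; local = λ i M≋M′ k → insertAt-cong j (M≋M′ i ≡.refl) k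
    }
    where
    insertAt-cong : ∀ {n} (j : Fin (suc n)) {u v : Vector Carrier n} → u ≋ v → insertAt u j 0# ≋ insertAt v j 0#
    insertAt-cong         zero    eq zero    = refl
    insertAt-cong         zero    eq (suc k) = eq k
    insertAt-cong {suc n} (suc j) eq zero    = eq zero
    insertAt-cong {suc n} (suc j) eq (suc k) = insertAt-cong j (λ l → eq (suc l)) k

  permutation-isRowMap : ∀ {m n} (σ : Permutation m n) →
    IsRowMap (λ (M : Matrix n) i k → M (σ ⟨$⟩ʳ i) (σ ⟨$⟩ʳ k))
  permutation-isRowMap σ = record
    -- Row `σ ⟨$⟩ʳ j` is read at place `j`, so row `i` lands at the inverse image of `i`.
    { index = σ ⟨$⟩ˡ_
    ; index-injective = λ eq → ≡.trans (≡.sym (inverseʳ σ)) (≡.trans (≡.cong (σ ⟨$⟩ʳ_) eq) (inverseʳ σ))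
    ; transform = λ row k → row (σ ⟨$⟩ʳ k)
    ; transform-linear = λ _ eq k → eq (σ ⟨$⟩ʳ k)
    ; at-index = λ M i k → reflexive (≡.cong (λ i → M i (σ ⟨$⟩ʳ k)) (inverseʳ σ))
    ; local = λ j M≋M′ k → M≋M′ (σ ⟨$⟩ʳ j) (inverseˡ σ) (σ ⟨$⟩ʳ k)
    }

  -- Bringing row j to the top crosses j rows, at a factor -1 each: one exchange with the first row,
  -- then induction with that row frozen.
  alternating-rotate : ∀ {n d} {F : Rows (suc n) d → Carrier} → IsAlternating F →
    ∀ j M → F (M j ∷ removeAt M j) ≈ sign j * F M
  alternating-rotate F-alt zero M =
    trans (F-cong (λ i → ≋-sym (∷-eta M i))) (sym (*-identityˡ _))
    where open IsAlternating F-alt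
  alternating-rotate {suc n} {F = F} F-alt (suc j) M = begin
    F (M (suc j) ∷ removeAt M (suc j))
      ≈⟨ F-cong (λ { zero _ → refl ; (suc zero) _ → refl ; (suc (suc i)) _ → refl }) ⟩
    F (M (suc j) ∷ M zero ∷ removeAt (tail M) j)
      ≈⟨ swap-head isMultilinear (vanishes λ ()) _ _ _ ⟩
    - F (M zero ∷ M (suc j) ∷ removeAt (tail M) j)
      ≈⟨ -‿cong (alternating-rotate (alternating-∘ (∷-isRowMap (M zero)) F-alt) j (tail M)) ⟩
    - (sign j * F (M zero ∷ tail M))
      ≈⟨ -‿cong (*-congˡ (F-cong (∷-eta M))) ⟨
    - (sign j * F M)
      ≈⟨ -1*x≈-x _ ⟨
    - 1# * (sign j * F M)
      ≈⟨ *-assoc _ _ _ ⟨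
    - 1# * sign j * F M ∎
    where open IsAlternating F-alt

  -- Multilinearity in the first row leaves a unit vector e_j on top, and clearing column j below it
  -- leaves an alternating function of the j-th minor. By induction this reproduces the Laplace
  -- expansion term by term, `alternating-rotate` supplying the sign.
  alternating-unique : ∀ {n} {F : Matrix n → Carrier} → IsAlternating F →
    ∀ M → F M ≈ det M * F identity
  alternating-unique {zero} F-alt M = trans (F-cong λ ()) (sym (*-identityˡ _))
    where open IsAlternating F-alt
  alternating-unique {suc n} {F} F-alt M = begin
    F M
      ≈⟨ F-cong (λ { zero k → sum-identity (M zero) k ; (suc i) _ → refl }) ⟩
    F ((λ k → sum λ j → M zero j * identity j k) ∷ tail M)
      ≈⟨ linear-head-sum isMultilinear (M zero) identity (tail M) ⟩
    sum (λ j → M zero j * F (identity j ∷ tail M))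
      ≈⟨ sum-cong-≋ (λ j → trans (*-congˡ (unit-head j)) (regroup (M zero j) (sign j) (det (minor M j)) (F identity))) ⟩
    sum (λ j → sign j * (M zero j * det (minor M j)) * F identity)
      ≈⟨ *-distribʳ-sum (F identity) (λ j → sign j * (M zero j * det (minor M j))) ⟨
    det M * F identity ∎
    where
    open IsAlternating F-alt
    regroup : ∀ m s D f → m * (D * (s * f)) ≈ s * (m * D) * f
    regroup = solve 4 (λ m s D f → m :* (D :* (s :* f)) := s :* (m :* D) :* f) refl
    unit-head : ∀ j → F (identity j ∷ tail M) ≈ det (minor M j) * (sign j * F identity)
    unit-head j = begin
      F (identity j ∷ tail M)
        -- Each lower row loses its j-th entry times e_j. A lower row equal to e_j would repeat the
        -- top row, which is why the extra terms vanish.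
        ≈⟨ shear (multilinear-∘ (∷-isRowMap (identity j)) isMultilinear) (λ _ → identity j)
             (λ i N Nᵢ≋eⱼ → vanishes {zero} {suc i} (λ ()) (identity j ∷ N) (≋-sym Nᵢ≋eⱼ))
             (λ i → tail M i j) (tail M) _ (λ i → split-coordinate (tail M i) j) ⟩
      F (identity j ∷ map (λ row → insertAt row j 0#) (minor M j))
        ≈⟨ alternating-unique (alternating-∘ (insertAt-isRowMap j) (alternating-∘ (∷-isRowMap (identity j)) F-alt)) (minor M j) ⟩
      det (minor M j) * F (identity j ∷ map (λ row → insertAt row j 0#) identity)
        ≈⟨ *-congˡ (F-cong λ { zero _ → refl ; (suc i) k → reflexive (insertAt-identity j i k) }) ⟩
      det (minor M j) * F (identity j ∷ removeAt identity j)
        ≈⟨ *-congˡ (alternating-rotate F-alt j identity) ⟩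
      det (minor M j) * (sign j * F identity) ∎

  det-permute : ∀ {m n} (σ : Permutation m n) (M : Matrix n) →
    det (λ i k → M (σ ⟨$⟩ʳ i) (σ ⟨$⟩ʳ k)) ≈ det M
  -- In the application the sizes are the products m·N and N·m, equal but not by computation.
  -- Identifying them makes `det identity` the same element for both.
  det-permute {m} σ M with ≡.refl ← ↔⇒≡ σ = begin
    det (λ i k → M (σ ⟨$⟩ʳ i) (σ ⟨$⟩ʳ k))
      ≈⟨ alternating-unique (alternating-∘ (permutation-isRowMap σ) det-alternating) M ⟩
    det M * det {m} (λ i k → identity (σ ⟨$⟩ʳ i) (σ ⟨$⟩ʳ k))
      ≈⟨ *-congˡ (det-cong {m} λ i k → reflexive (identity-injective (σ ⟨$⟩ʳ_) σ-injective i k)) ⟩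
    det M * det {m} identity
      -- Uniqueness for `det` itself, read from right to left, absorbs the factor `det identity`.
      ≈⟨ alternating-unique det-alternating M ⟨
    det M ∎
    where
    σ-injective : ∀ {i j} → σ ⟨$⟩ʳ i ≡ σ ⟨$⟩ʳ j → i ≡ j
    σ-injective eq = ≡.trans (≡.sym (inverseˡ σ)) (≡.trans (≡.cong (σ ⟨$⟩ˡ_) eq) (inverseˡ σ))

  -- Block matrices

  upperLeft : ∀ {m n} → Matrix (m ℕ.+ n) → Matrix m
  upperLeft {n = n} M i j = M (i ↑ˡ n) (j ↑ˡ n)

  lowerRight : ∀ m {n} → Matrix (m ℕ.+ n) → Matrix n
  lowerRight m M i j = M (m ↑ʳ i) (m ↑ʳ j)

  -- In the expansion along the first row the right columns contribute zero entries. Deleting a left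
  -- column preserves the zero block and the lower right block, so induction on `m` applies to the
  -- minors.
  det-blockTriangular : ∀ m {n} (M : Matrix (m ℕ.+ n)) → (∀ i j → M (i ↑ˡ n) (m ↑ʳ j) ≈ 0#) →
    det M ≈ det (upperLeft {m} M) * det (lowerRight m M)
  det-blockTriangular zero        M upperRight≈0 = sym (*-identityˡ _)
  det-blockTriangular (suc m) {n} M upperRight≈0 = begin
    det M
      ≈⟨ sum-↑ (suc m) term ⟩
    sum (λ j → term (j ↑ˡ n)) + sum (λ j → term (suc m ↑ʳ j))
      ≈⟨ +-cong (sum-cong-≋ left) (sum-zero right) ⟩
    sum (λ j → term′ j * det (lowerRight (suc m) M)) + 0#
      ≈⟨ +-identityʳ _ ⟩
    sum (λ j → term′ j * det (lowerRight (suc m) M))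
      ≈⟨ *-distribʳ-sum (det (lowerRight (suc m) M)) term′ ⟨
    det (upperLeft {suc m} M) * det (lowerRight (suc m) M) ∎
    where
    term : Fin (suc m ℕ.+ n) → Carrier
    term j = sign j * (M zero j * det (minor M j))
    term′ : Fin (suc m) → Carrier
    term′ j = sign j * (upperLeft {suc m} M zero j * det (minor (upperLeft {suc m} M) j))
    left : ∀ j → term (j ↑ˡ n) ≈ term′ j * det (lowerRight (suc m) M)
    left j = begin
      sign (j ↑ˡ n) * (M zero (j ↑ˡ n) * det (minor M (j ↑ˡ n)))
        -- A left column has the same number in the whole matrix and in its upper left block, so the
        -- cofactor signs agree.
        ≈⟨ *-cong (reflexive (≡.cong ((- 1#) ^_) (toℕ-↑ˡ j n)))
             (*-congˡ (det-blockTriangular m (minor M (j ↑ˡ n)) λ i k →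
               trans (reflexive (≡.cong (M (suc (i ↑ˡ n))) (punchIn-↑ʳ j k))) (upperRight≈0 (suc i) k))) ⟩
      sign j * (M zero (j ↑ˡ n) * (det (upperLeft {m} (minor M (j ↑ˡ n))) * det (lowerRight m (minor M (j ↑ˡ n)))))
        ≈⟨ *-congˡ (*-congˡ (*-cong
             (det-cong λ i k → reflexive (≡.cong (M (suc (i ↑ˡ n))) (punchIn-↑ˡ j k n)))
             (det-cong λ i k → reflexive (≡.cong (M (suc (m ↑ʳ i))) (punchIn-↑ʳ j k))))) ⟩
      sign j * (M zero (j ↑ˡ n) * (det (minor (upperLeft {suc m} M) j) * det (lowerRight (suc m) M)))
        ≈⟨ solve 4 (λ s p D E → s :* (p :* (D :* E)) := s :* (p :* D) :* E) refl _ _ _ _ ⟩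
      term′ j * det (lowerRight (suc m) M) ∎
    right : ∀ j → term (suc m ↑ʳ j) ≈ 0#
    right j = trans (*-congˡ (trans (*-congʳ (upperRight≈0 zero j)) (zeroˡ _))) (zeroʳ (sign (suc m ↑ʳ j)))

  -- Subtracting a zero row or a lower row from each upper row preserves the determinant, and the
  -- second hypothesis says that this clears the upper right block. The zero alternative serves the
  -- case in which no block row remains below.
  det-blockElimination : ∀ m {n} (M : Matrix (m ℕ.+ n)) (g : Rows m (m ℕ.+ n)) →
    (∀ i → (∀ k → g i k ≈ 0#) ⊎ (∃[ j ] g i ≋ M (m ↑ʳ j))) →
    (∀ i j → M (i ↑ˡ n) (m ↑ʳ j) ≈ g i (m ↑ʳ j)) →
    det M ≈ det (λ i j → M (i ↑ˡ n) (j ↑ˡ n) - g i (j ↑ˡ n)) * det (lowerRight m M)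
  det-blockElimination m {n} M g g-rows M≈g = begin
    det M
      ≈⟨ det-cong (++-eta m M) ⟩
    det (take m M ++ drop m M)
      ≈⟨ shear (multilinear-∘ (++-isRowMap (drop m M)) det-multilinear) g kills (λ _ → 1#) (take m M) reduced restore ⟩
    det (reduced ++ drop m M)
      ≈⟨ det-blockTriangular m (reduced ++ drop m M) (λ i j →
           trans (top i (m ↑ʳ j)) (trans (+-congʳ (M≈g i j)) (-‿inverseʳ _))) ⟩
    det (upperLeft {m} (reduced ++ drop m M)) * det (lowerRight m (reduced ++ drop m M))
      ≈⟨ *-cong (det-cong λ i j → top i (j ↑ˡ n))
                (det-cong λ i j → bottom reduced i (m ↑ʳ j)) ⟩
    det (λ i j → M (i ↑ˡ n) (j ↑ˡ n) - g i (j ↑ˡ n)) * det (lowerRight m M) ∎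
    where
    reduced : Rows m (m ℕ.+ n)
    reduced i k = M (i ↑ˡ n) k - g i k
    top : ∀ {v : Rows m (m ℕ.+ n)} i → (v ++ drop m M) (i ↑ˡ n) ≋ v i
    top {v} i k = reflexive (≡.cong-app (lookup-++ˡ v (drop m M) i) k)
    bottom : ∀ (v : Rows m (m ℕ.+ n)) j → (v ++ drop m M) (m ↑ʳ j) ≋ M (m ↑ʳ j)
    bottom v j k = reflexive (≡.cong-app (lookup-++ʳ v (drop m M) j) k)
    restore : ∀ i k → M (i ↑ˡ n) k ≈ reduced i k + 1# * g i k
    restore i k = begin
      M (i ↑ˡ n) k                           ≈⟨ +-identityʳ _ ⟨
      M (i ↑ˡ n) k + 0#                      ≈⟨ +-congˡ (-‿inverseˡ _) ⟨
      M (i ↑ˡ n) k + (- g i k + g i k)       ≈⟨ +-assoc _ _ _ ⟨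
      reduced i k + g i k                    ≈⟨ +-congˡ (*-identityˡ _) ⟨
      reduced i k + 1# * g i k               ∎
    -- The upper rows `v` are arbitrary: the reduction leaves the lower rows intact, so a copy of
    -- one of them always meets its original.
    kills : ∀ i v → v i ≋ g i → det (v ++ drop m M) ≈ 0#
    kills i v vᵢ≋gᵢ with g-rows i
    ... | inj₁ gᵢ≈0       = IsMultilinear.zero-row det-multilinear (i ↑ˡ n) (v ++ drop m M)
                              (≋-trans (top {v} i) (≋-trans vᵢ≋gᵢ gᵢ≈0))
    ... | inj₂ (j , gᵢ≋Mⱼ) = det-vanishes (↑ˡ≢↑ʳ i j) (v ++ drop m M)
                              (≋-trans (top {v} i) (≋-trans vᵢ≋gᵢ (≋-trans gᵢ≋Mⱼ (≋-sym (bottom v j)))))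

  -- Block matrices indexed by position, and the recursion on m.

  blockMatrix-combine : ∀ {N m} (B : Fin N → Fin N → Matrix m) r s p q →
    blockMatrix B (combine r p) (combine s q) ≡ B r s p q
  blockMatrix-combine {N} {m} B r s p q =
    ≡.cong₂ (λ { (r , p) (s , q) → B r s p q }) (remQuot-combine r p) (remQuot-combine s q)

  -- `combine (suc i) j` unfolds to `n ↑ʳ combine i j`; likewise `combine zero r` unfolds to
  -- `r ↑ˡ _`, which is how the first block row is read off below.
  remQuot-↑ʳ : ∀ {m} n (a : Fin (m ℕ.* n)) →
    remQuot {suc m} n (n ↑ʳ a) ≡ (suc (quotient {m} n a) , remainder {m} n a)
  remQuot-↑ʳ {m} n a = ≡.trans (≡.cong (remQuot {suc m} n ∘ (n ↑ʳ_)) (≡.sym (combine-remQuot {m} n a)))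
    (remQuot-combine (suc (quotient {m} n a)) (remainder {m} n a))

  maxBlocks : ∀ {N m} → (Fin N → Fin N → Vector Carrier m) → Matrix (m ℕ.* N)
  maxBlocks x = blockMatrix λ p q r s → x r s (p ⊔ᶠ q)

  module _ {N m} (x : Fin N → Fin N → Vector Carrier (suc m)) where

    maxBlocks-top : ∀ r s → maxBlocks x (r ↑ˡ m ℕ.* N) (s ↑ˡ m ℕ.* N) ≡ x r s zero
    maxBlocks-top r s = blockMatrix-combine {suc m} (λ p q r s → x r s (p ⊔ᶠ q)) zero zero r s

    maxBlocks-bottom : ∀ a b → maxBlocks x (N ↑ʳ a) (N ↑ʳ b) ≡ maxBlocks (λ r s → tail (x r s)) a b
    maxBlocks-bottom a b =
      ≡.cong₂ (λ { (p , r) (q , s) → x r s (p ⊔ᶠ q) }) (remQuot-↑ʳ {m} N a) (remQuot-↑ʳ {m} N b)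

    maxBlocks-topʳ : ∀ r b → maxBlocks x (r ↑ˡ m ℕ.* N) (N ↑ʳ b) ≡ x r (remainder {m} N b) (suc (quotient {m} N b))
    maxBlocks-topʳ r b =
      ≡.cong₂ (λ { (p , r) (q , s) → x r s (p ⊔ᶠ q) }) (remQuot-combine {suc m} zero r) (remQuot-↑ʳ {m} N b)

  det-maxBlocks : ∀ {N} m (x : Fin N → Fin N → Vector Carrier m) →
    det (maxBlocks x) ≈ product (λ i → det (X x i))
  det-maxBlocks zero    x = refl
  det-maxBlocks {N} (suc m) x = begin
    det (maxBlocks x)
      ≈⟨ step m x ⟩
    det (X x zero) * det (lowerRight N (maxBlocks x))
      ≈⟨ *-congˡ (det-cong λ a b → reflexive (maxBlocks-bottom x a b)) ⟩
    det (X x zero) * det (maxBlocks (λ r s → tail (x r s)))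
      -- Since `extended` appends its zero at the far end, `X` of the tails at `i` computes to
      -- `X x (suc i)`.
      ≈⟨ *-congˡ (det-maxBlocks m λ r s → tail (x r s)) ⟩
    det (X x zero) * product (λ i → det (X x (suc i))) ∎
    where
    step : ∀ m (x : Fin N → Fin N → Vector Carrier (suc m)) →
      det (maxBlocks x) ≈ det (X x zero) * det (lowerRight N (maxBlocks x))
    step zero x = trans
      -- With a single block the subtracted row is zero, in agreement with the convention x_{m+1} =
      -- 0 in `X`.
      (det-blockElimination N (maxBlocks x) (λ _ _ → 0#) (λ _ → inj₁ λ _ → refl) λ _ ())
      (*-congʳ (det-cong λ r s → +-congʳ (reflexive (maxBlocks-top x r s))))
    step (suc m) x = trans
      -- Here `g` is the second block row. In 0-based block column q ≥ 1 the maxima of 0 and of 1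
      -- with q are both q, so the two block rows agree; in column 0 their difference is X_{(1,2)}.
      (det-blockElimination N (maxBlocks x) (λ r → maxBlocks x (N ↑ʳ (r ↑ˡ m ℕ.* N)))
        (λ r → inj₂ (r ↑ˡ m ℕ.* N , λ _ → refl))
        (λ r b → reflexive (≡.trans (maxBlocks-topʳ x r b) (≡.sym (≡.trans (maxBlocks-bottom x _ b) (second r b))))))
      (*-congʳ (det-cong λ r s → reflexive (≡.cong₂ _-_ (maxBlocks-top x r s)
        (blockMatrix-combine (λ p q r s → x r s (p ⊔ᶠ q)) (suc zero) zero r s))))
      where
      second : ∀ r b → maxBlocks (λ r s → tail (x r s)) (r ↑ˡ m ℕ.* N) b
        ≡ x r (remainder {suc m} N b) (suc (quotient {suc m} N b))
      second r b = ≡.cong (λ { (p , r) → x r (remainder {suc m} N b) (suc (p ⊔ᶠ quotient {suc m} N b)) })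
        (remQuot-combine {suc m} zero r)

  A-positionFirst : ∀ {N m} (x : Fin N → Fin N → Vector Carrier m) a b →
    A x (positionFirst N m ⟨$⟩ʳ a) (positionFirst N m ⟨$⟩ʳ b) ≡ maxBlocks x a b
  A-positionFirst {N} {m} x a b = ≡.trans
    (blockMatrix-combine (λ r s → A-block (x r s))
      (remainder {m} N a) (remainder {m} N b) (opposite (quotient {m} N a)) (opposite (quotient {m} N b)))
    (≡.cong (x (remainder {m} N a) (remainder {m} N b)) (opposite-⊓ (quotient {m} N a) (quotient {m} N b)))

theorem2p1 : ∀ {c ℓ} (R : CommutativeRing c ℓ) (N m : ℕ) → 2 ≤ N → 1 ≤ m →
    let open CommutativeRing R
        open Matrices R
    in (x : Fin N → Fin N → Fin m → Carrier) →
       det (A x) ≈ product (λ i → det (X x i))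
theorem2p1 R N m _ _ x = begin
  det (A x)
    ≈⟨ det-permute (positionFirst N m) (A x) ⟨
  det (λ a b → A x (positionFirst N m ⟨$⟩ʳ a) (positionFirst N m ⟨$⟩ʳ b))
    ≈⟨ det-cong (λ a b → reflexive (A-positionFirst x a b)) ⟩
  det (maxBlocks x)
    ≈⟨ det-maxBlocks m x ⟩
  product (λ i → det (X x i)) ∎
  where
  open CommutativeRing R
  open Matrices R
  open Determinants R
  open SetoidReasoning setoid
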